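{- Let $r \in \mathbb{N}\setminus \{1\}$. Then \[\left \lceil \frac{2^r - 1}{3} \right \rceil \le \mathsf{D}_0(C_2^r)\le \left \lceil \frac{2^r - 1}{3}\right \rceil + 2^{r/2}.\]
   Context: $C_2^r$ is the elementary abelian $2$-group of rank $r$. A sequence over a finite abelian group $G$ is a finite unordered list of elements with repetitions; zero-sum means its terms sum to $0$. $\mathsf{D}_k(G)$ ($k\in\mathbb{N}$) is the smallest $\ell$ such that every sequence over $G$ of length at least $\ell$ has $k$ disjoint non-empty zero-sum subsequences. $\mathsf{D}_0(G)\in\mathbb{N}_0$ denotes the (known to exist) integer such that $\mathsf{D}_k(G)=\mathsf{D}_0(G)+k\exp(G)$ for all sufficiently large $k$. -}

module Defs where

open import Algebra.Bundles using (AbelianGroup; CommutativeRing)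
import Algebra.Construct.Pointwise as Pointwise
import Algebra.Definitions.RawMonoid as RawMonoidDefinitions
open import Data.Bool.Properties using (xor-∧-commutativeRing)
open import Data.Fin.Base using (Fin)
open import Data.Integer.Base as ℤ using (ℤ; +_)
open import Data.List.Base using (List; []; _++_; concat; foldr; length)
open import Data.List.Relation.Unary.All using (All)
import Data.List.Relation.Binary.Permutation.Setoid as Permutation
open import Data.Nat.Base using (ℕ; _+_; _*_; _≤_; _<_)
open import Data.Product.Base using (_×_; ∃-syntax)
open import Data.Sum.Base using (_⊎_)
open import Level using (Level; _⊔_; 0ℓ)
open import Relation.Binary.PropositionalEquality.Core using (_≡_; _≢_)

IsLeast : ∀ {p : Level} → (ℕ → Set p) → ℕ → Set p
IsLeast P n = P n × (∀ m → P m → n ≤ m)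

module _ {c ℓ : Level} (G : AbelianGroup c ℓ) where

  open AbelianGroup G using (Carrier; _≈_; _∙_; ε; setoid; rawMonoid)
  open Permutation setoid using (_↭_)
  open RawMonoidDefinitions rawMonoid using () renaming (_×_ to _·_)

  IsExponent : ℕ → Set (c ⊔ ℓ)
  IsExponent = IsLeast (λ n → 0 < n × (∀ x → n · x ≈ ε))

  -- Sequences are lists; every notion below is invariant under _↭_, so the
  -- order of the terms is immaterial.
  ZeroSum : List Carrier → Set ℓ
  ZeroSum S = foldr _∙_ ε S ≈ ε

  -- T₁, …, T_k are disjoint subsequences of S when, as multisets,
  -- S is T₁ ⋯ T_k together with some remaining terms R.
  HasDisjointZeroSums : ℕ → List Carrier → Set (c ⊔ ℓ)
  HasDisjointZeroSums k S =
    ∃[ Ts ] ∃[ R ]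
      length Ts ≡ k
      × All (λ T → T ≢ [] × ZeroSum T) Ts
      × S ↭ concat Ts ++ R

  -- IsD k l :  D_k(G) = l
  IsD : ℕ → ℕ → Set (c ⊔ ℓ)
  IsD k = IsLeast (λ l → ∀ S → l ≤ length S → HasDisjointZeroSums k S)

  -- IsD₀ d :  D₀(G) = d
  IsD₀ : ℕ → Set (c ⊔ ℓ)
  IsD₀ d = ∃[ e ] (IsExponent e × ∃[ K ] (∀ k → K ≤ k → IsD k (d + k * e)))

C₂ : AbelianGroup 0ℓ 0ℓ
C₂ = CommutativeRing.+-abelianGroup xor-∧-commutativeRing

C₂^_ : ℕ → AbelianGroup 0ℓ 0ℓ
C₂^ r = Pointwise.abelianGroup (Fin r) C₂

infix 4 _≤√_

-- The real inequality x ≤ √n, for an integer x.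
_≤√_ : ℤ → ℕ → Set
x ≤√ n = x ℤ.≤ + 0 ⊎ x ℤ.* x ℤ.≤ + n

{-# OPTIONS --safe #-}
module Submission where

-- Upper bound.  F₂^r without 0 is covered by lines {x, y, x + y} and at most seven
-- single points.  After cancelling equal pairs, every line either lies completely
-- in the sequence, and is split off, or leaves at most two terms.  Among any 2q
-- remaining terms with q² > 2^r, two sums x + y with x from the first q terms and y
-- from the others coincide, so zero-sum subsequences of length at most 4 can be
-- split off until fewer than 2q terms are left.
--
-- Lower bound.  Take every element except 0 and some g ≠ 0, together with 2m copies
-- of g.  A zero-sum subsequence is a pair (g , g) or has length at least 3, and the
-- whole sequence has sum g, so a term is always left over.

open import Defs
open import Algebra.Bundles using (AbelianGroup)
import Algebra.Properties.Group
open import Data.Bool.Base using (Bool; true; false; not; _xor_; if_then_else_)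
open import Data.Bool.Properties using (not-involutive; not-injective; xor-assoc; xor-comm; xor-identityˡ; xor-identityʳ; xor-same)
open import Data.Fin.Base as Fin using (Fin; zero; suc)
open import Data.Fin.Properties as Fin using (pigeonhole)
open import Data.Integer.Base as ℤ using (ℤ; +_)
import Data.Integer.Properties as ℤ
open import Data.List.Base as List using (List; []; _∷_; [_]; _++_; map; concat; foldr; length)
open import Data.List.Properties as List using (length-map; length-++; concat-map)
open import Data.List.Membership.Propositional using (_∈_)
open import Data.List.Membership.Propositional.Properties using (∈-map⁺; ∈-++⁺ˡ; ∈-++⁺ʳ)
import Data.List.Relation.Binary.Pointwise as Pointwise
open import Data.List.Relation.Binary.Permutation.Propositional using (_↭_; ↭-refl; ↭-sym; ↭-trans; ↭-reflexive; prep; swap; ↭⇒↭ₛ; ↭ₛ⇒↭)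
import Data.List.Relation.Binary.Permutation.Setoid as PermutationSetoid
import Data.List.Relation.Binary.Permutation.Setoid.Properties as PermutationSetoidₚ
open import Data.List.Relation.Binary.Permutation.Propositional.Properties as Permutation using (shifts; ↭-length)
open import Data.List.Relation.Unary.All as All using (All; []; _∷_)
import Data.List.Relation.Unary.All.Properties as All
open import Data.List.Relation.Unary.Any as Any using (Any; here; there)
import Data.List.Relation.Unary.Any.Properties as Any
open import Data.Nat.Base hiding (_/_)
open import Data.Nat.Properties
open import Data.Nat.DivMod using (m*n%n≡0; m*n/n≡m; [m+kn]%n≡m%n; +-distrib-/-∣ʳ)
open import Data.Nat.Divisibility using (divides-refl)
open import Data.Nat.ListAction using (sum)
open import Data.Nat.ListAction.Properties using (sum-++; sum-↭)
open import Data.Nat.Tactic.RingSolver using (solve-∀)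
open import Data.Product.Base using (_×_; _,_; proj₁; proj₂; ∃-syntax)
open import Data.Rational.Unnormalised.Base using (_/_; ceiling)
open import Data.Sum.Base as Sum using (_⊎_; inj₁; inj₂)
open import Data.Vec.Base as Vec using (Vec; []; _∷_)
open import Data.Vec.Properties as Vec using (zipWith-assoc; zipWith-comm; zipWith-identityˡ; zipWith-identityʳ)
open import Function.Base using (_∘_; id)
open import Level using (Level; 0ℓ)
open import Relation.Binary.PropositionalEquality hiding ([_])
open import Relation.Nullary using (¬_; yes; no; contradiction)

private variable
  r : ℕ

-- Bit vectors as a model of the elementary abelian 2-group.

V : ℕ → Set
V = Vec Bool

infixl 6 _⊕_

_⊕_ : V r → V r → V r
_⊕_ = Vec.zipWith _xor_

𝟎 : V r
𝟎 = Vec.replicate _ false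

⊕-assoc : (x y z : V r) → (x ⊕ y) ⊕ z ≡ x ⊕ (y ⊕ z)
⊕-assoc = zipWith-assoc xor-assoc

⊕-comm : (x y : V r) → x ⊕ y ≡ y ⊕ x
⊕-comm = zipWith-comm xor-comm

⊕-identityˡ : (x : V r) → 𝟎 ⊕ x ≡ x
⊕-identityˡ = zipWith-identityˡ xor-identityˡ

⊕-identityʳ : (x : V r) → x ⊕ 𝟎 ≡ x
⊕-identityʳ = zipWith-identityʳ xor-identityʳ

⊕-self : (x : V r) → x ⊕ x ≡ 𝟎
⊕-self []      = refl
⊕-self (a ∷ x) = cong₂ _∷_ (xor-same a) (⊕-self x)

-- Unlike the functions of `C₂^ r`, whose equality is pointwise, vectors have propositional
-- equality, so matching on `refl` and propositional permutations become available.
vectorGroup : ℕ → AbelianGroup 0ℓ 0ℓ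
vectorGroup r = record
  { Carrier        = V r
  ; _≈_            = _≡_
  ; _∙_            = _⊕_
  ; ε              = 𝟎
  ; _⁻¹            = id
  ; isAbelianGroup = record
    { isGroup = record
      { isMonoid = record
        { isSemigroup = record
          { isMagma = record { isEquivalence = isEquivalence ; ∙-cong = cong₂ _⊕_ }
          ; assoc   = ⊕-assoc
          }
        ; identity = ⊕-identityˡ , ⊕-identityʳ
        }
      ; inverse = ⊕-self , ⊕-self
      ; ⁻¹-cong = id
      }
    ; comm = ⊕-comm
    }
  }

module _ {r : ℕ} where
  open Algebra.Properties.Group (AbelianGroup.group (vectorGroup r)) public
    using () renaming (∙-cancelˡ to ⊕-cancelˡ; ∙-cancelʳ to ⊕-cancelʳ; inverseˡ-unique to ⊕≡𝟎⇒≡)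

⨁ : List (V r) → V r
⨁ = foldr _⊕_ 𝟎

⨁-++ : (S T : List (V r)) → ⨁ (S ++ T) ≡ ⨁ S ⊕ ⨁ T
⨁-++ []      T = sym (⊕-identityˡ _)
⨁-++ (x ∷ S) T = trans (cong (x ⊕_) (⨁-++ S T)) (sym (⊕-assoc x _ _))

⨁-concat : {Ts : List (List (V r))} → All (λ T → T ≢ [] × ⨁ T ≡ 𝟎) Ts → ⨁ (concat Ts) ≡ 𝟎
⨁-concat []                           = refl
⨁-concat {Ts = T ∷ Ts} ((_ , p) ∷ ps) =
  trans (⨁-++ T (concat Ts)) (trans (cong₂ _⊕_ p (⨁-concat ps)) (⊕-identityˡ 𝟎))

⨁-↭ : {S T : List (V r)} → S ↭ T → ⨁ S ≡ ⨁ T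
⨁-↭ {r} S↭T = PermutationSetoidₚ.foldr-commMonoid (setoid (V r)) (AbelianGroup.isCommutativeMonoid (vectorGroup r)) (↭⇒↭ₛ S↭T)

pair-zeroSum : {x y : V r} → x ≡ y → ⨁ (x ∷ y ∷ []) ≡ 𝟎
pair-zeroSum {x = x} refl = trans (cong (x ⊕_) (⊕-identityʳ x)) (⊕-self x)

-- Transport of disjoint zero-sum subsequences

module _ {c₁ ℓ₁ c₂ ℓ₂ : Level} (G : AbelianGroup c₁ ℓ₁) (H : AbelianGroup c₂ ℓ₂) where

  private
    module G = AbelianGroup G
    module H = AbelianGroup H

  module _ (f : G.Carrier → H.Carrier)
           (f-cong : ∀ {x y} → x G.≈ y → f x H.≈ f y)
           (f-ε : f G.ε H.≈ H.ε)
           (f-∙ : ∀ x y → f (x G.∙ y) H.≈ f x H.∙ f y) where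

    map-sum : ∀ S → foldr H._∙_ H.ε (map f S) H.≈ f (foldr G._∙_ G.ε S)
    map-sum []      = H.sym f-ε
    map-sum (x ∷ S) = H.trans (H.∙-cong H.refl (map-sum S)) (H.sym (f-∙ x _))

    map-zeroSum : ∀ {T} → T ≢ [] × ZeroSum G T → map f T ≢ [] × ZeroSum H (map f T)
    map-zeroSum {[]}    (T≢[] , _) = contradiction refl T≢[]
    map-zeroSum {x ∷ T} (_ , p)    = (λ ()) , H.trans (map-sum (x ∷ T)) (H.trans (f-cong p) f-ε)

    map-hasDisjointZeroSums : ∀ {k S} → HasDisjointZeroSums G k S → HasDisjointZeroSums H k (map f S)
    map-hasDisjointZeroSums {S = S} (Ts , R , len , zs , p) =
      map (map f) Ts , map f R , trans (length-map (map f) Ts) len , All.map⁺ (All.map map-zeroSum zs) ,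
      PermutationSetoid.↭-trans H.setoid (PermutationSetoidₚ.map⁺ G.setoid H.setoid f-cong p)
        (PermutationSetoid.↭-reflexive H.setoid
          (trans (List.map-++ f (concat Ts) R) (cong (_++ map f R) (sym (concat-map Ts)))))

-- The decomposition is pulled back along `Vec.lookup`. It then decomposes a list that agrees with
-- `S` only pointwise, a difference that the setoid permutation absorbs.
hasDisjointZeroSums-tabulate : ∀ {k} (S : List (Fin r → Bool)) →
  HasDisjointZeroSums (vectorGroup r) k (map Vec.tabulate S) → HasDisjointZeroSums (C₂^ r) k S
hasDisjointZeroSums-tabulate {r} S h
  with Ts , R , len , zs , p ← map-hasDisjointZeroSums (vectorGroup r) (C₂^ r) Vec.lookup
         (λ { refl i → refl }) (λ i → Vec.lookup-replicate i false) (λ x y i → Vec.lookup-zipWith _xor_ i x y) h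
  = Ts , R , len , zs , PermutationSetoid.↭-trans (AbelianGroup.setoid (C₂^ r)) (PermutationSetoid.refl (roundtrip S)) p
  where
  roundtrip : ∀ S → Pointwise.Pointwise (AbelianGroup._≈_ (C₂^ r)) S (map Vec.lookup (map Vec.tabulate S))
  roundtrip []      = Pointwise.[]
  roundtrip (x ∷ S) = (λ i → sym (Vec.lookup∘tabulate x i)) Pointwise.∷ roundtrip S

hasDisjointZeroSums-lookup : ∀ {k} (S : List (V r)) →
  HasDisjointZeroSums (C₂^ r) k (map Vec.lookup S) → HasDisjointZeroSums (vectorGroup r) k S
hasDisjointZeroSums-lookup {r} {k} S h =
  subst (HasDisjointZeroSums (vectorGroup r) k)
    (trans (sym (List.map-∘ S)) (trans (List.map-cong Vec.tabulate∘lookup S) (List.map-id S)))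
    (map-hasDisjointZeroSums (C₂^ r) (vectorGroup r) Vec.tabulate Vec.tabulate-cong
      (tabulate-𝟎 r) tabulate-⊕ h)
  where
  tabulate-𝟎 : ∀ r → Vec.tabulate {n = r} (λ _ → false) ≡ 𝟎
  tabulate-𝟎 zero    = refl
  tabulate-𝟎 (suc r) = cong (false ∷_) (tabulate-𝟎 r)

  tabulate-⊕ : ∀ {r} (x y : Fin r → Bool) →
    Vec.tabulate (λ i → x i xor y i) ≡ Vec.tabulate x ⊕ Vec.tabulate y
  tabulate-⊕ {zero}  x y = refl
  tabulate-⊕ {suc r} x y = cong ((x zero xor y zero) ∷_) (tabulate-⊕ (x ∘ suc) (y ∘ suc))

-- Removing zero-sum subsequences one at a time

infix 4 _⟶[_]_

data _⟶[_]_ {r} : List (V r) → ℕ → List (V r) → Set where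
  done   : ∀ {S S′} → S ↭ S′ → S ⟶[ 0 ] S′
  remove : ∀ {S S₁ S′ c} T → T ≢ [] → ⨁ T ≡ 𝟎 → S ↭ T ++ S₁ → S₁ ⟶[ c ] S′ → S ⟶[ suc c ] S′

module _ {r : ℕ} where

  private variable
    S S′ S″ T T′ : List (V r)
    c c′ k B B′ : ℕ
    P Q : V r → Set

  ⟶-respˡ : S ↭ T → T ⟶[ c ] S′ → S ⟶[ c ] S′
  ⟶-respˡ p (done q)           = done (↭-trans p q)
  ⟶-respˡ p (remove T n z q t) = remove T n z (↭-trans p q) t

  ⟶-trans : S ⟶[ c ] S′ → S′ ⟶[ c′ ] S″ → S ⟶[ c + c′ ] S″
  ⟶-trans (done p)           t′ = ⟶-respˡ p t′
  ⟶-trans (remove T n z p t) t′ = remove T n z p (⟶-trans t t′)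

  ⟶-++ : S ⟶[ c ] S′ → T ⟶[ c′ ] T′ → S ++ T ⟶[ c + c′ ] S′ ++ T′
  ⟶-++ (done p) (done q) = done (Permutation.++⁺ p q)
  ⟶-++ {S = S} (done p) (remove U n z q t) =
    remove U n z (↭-trans (Permutation.++⁺ˡ S q) (shifts S U)) (⟶-++ (done p) t)
  ⟶-++ {T = T} (remove U n z p t) t′ =
    remove U n z (↭-trans (Permutation.++⁺ʳ T p) (↭-reflexive (List.++-assoc U _ T))) (⟶-++ t t′)

  ⟶⇒hasDisjointZeroSums : S ⟶[ c ] S′ → k ≤ c → HasDisjointZeroSums (vectorGroup r) k S
  -- With `k` lists taken, all that is left, including the lists of further removals, becomes the
  -- remainder.
  ⟶⇒hasDisjointZeroSums {S = S} t z≤n = [] , S , refl , [] , ↭⇒↭ₛ ↭-refl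
  ⟶⇒hasDisjointZeroSums (remove T n z p t) (s≤s k≤c)
    with Ts , R , len , zs , q ← ⟶⇒hasDisjointZeroSums t k≤c
    = T ∷ Ts , R , cong suc len , (n , z) ∷ zs ,
      ↭⇒↭ₛ (↭-trans p (↭-trans (Permutation.++⁺ˡ T (↭ₛ⇒↭ q)) (↭-reflexive (sym (List.++-assoc T (concat Ts) R)))))

  -- Covering by lines and points

  PairsRemoved : List (V r) → List (V r) → Set
  PairsRemoved S S′ = ∃[ c ] (S ⟶[ c ] S′ × length S ≡ 2 * c + length S′)

  pairsRemoved-++ : PairsRemoved S S′ → PairsRemoved T T′ → PairsRemoved (S ++ T) (S′ ++ T′)
  pairsRemoved-++ {S} {S′} {T} {T′} (c , t , e) (c′ , t′ , e′) = c + c′ , ⟶-++ t t′ , (begin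
    length (S ++ T)                                    ≡⟨ length-++ S ⟩
    length S + length T                                ≡⟨ cong₂ _+_ e e′ ⟩
    (2 * c + length S′) + (2 * c′ + length T′)         ≡⟨ arith c (length S′) c′ (length T′) ⟩
    2 * (c + c′) + (length S′ + length T′)             ≡⟨ cong (λ n → 2 * (c + c′) + n) (length-++ S′) ⟨
    2 * (c + c′) + length (S′ ++ T′)                   ∎)
    where
    open ≡-Reasoning
    arith : ∀ a b c d → (2 * a + b) + (2 * c + d) ≡ 2 * (a + c) + (b + d)
    arith = solve-∀

  parityPart : Bool → V r → List (V r)
  parityPart b x = if b then [ x ] else []

  -- Two equal terms sum to zero, so only the parity of the multiplicity survives.
  removePairs : ∀ {x} → All (x ≡_) S → ∃[ b ] PairsRemoved S (parityPart b x)
  removePairs [] = false , 0 , done ↭-refl , refl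
  removePairs {S = x ∷ S} (refl ∷ ps) with removePairs ps
  ... | false , c , t , e = true , c , ⟶-++ (done (↭-refl {x = [ x ]})) t , trans (cong suc e) (arith c)
    where
    arith : ∀ c → suc (2 * c + 0) ≡ 2 * c + 1
    arith = solve-∀
  ... | true , c , t , e = false , c + 1 ,
    ⟶-trans (⟶-++ (done (↭-refl {x = [ x ]})) t)
      (remove (x ∷ x ∷ []) (λ ()) (pair-zeroSum refl) ↭-refl (done ↭-refl)) ,
    trans (cong suc e) (arith c)
    where
    arith : ∀ c → suc (2 * c + 1) ≡ 2 * (c + 1) + 0
    arith = solve-∀

  -- Splitting most of S′ into zero-sum quadruples will gain another |S′|/4, which
  -- turns this into |S| − 2c ≲ B/2; a line has B = 2 and a point B = 1.
  Reducible : ℕ → List (V r) → Set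
  Reducible B S = ∃[ c ] ∃[ S′ ] (S ⟶[ c ] S′ × 2 * length S ≤ 4 * c + length S′ + B)

  -- `B` is fixed before `S`: the defect must not grow with the multiplicities in the list.
  Cover : ℕ → (V r → Set) → Set
  Cover B P = ∀ S → All P S → Reducible B S

  reducible-↭ : S ↭ T → Reducible B T → Reducible B S
  reducible-↭ p (c , S′ , t , le) rewrite sym (↭-length p) = c , S′ , ⟶-respˡ p t , le

  reducible-++ : Reducible B S → Reducible B′ T → Reducible (B + B′) (S ++ T)
  reducible-++ {B} {S} {B′} {T} (c , S′ , t , le) (c′ , T′ , t′ , le′) =
    c + c′ , S′ ++ T′ , ⟶-++ t t′ , (begin
    2 * length (S ++ T)                                          ≡⟨ cong (2 *_) (length-++ S) ⟩
    2 * (length S + length T)                                    ≡⟨ *-distribˡ-+ 2 (length S) (length T) ⟩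
    2 * length S + 2 * length T                                  ≤⟨ +-mono-≤ le le′ ⟩
    (4 * c + length S′ + B) + (4 * c′ + length T′ + B′)          ≡⟨ arith c (length S′) B c′ (length T′) B′ ⟩
    4 * (c + c′) + (length S′ + length T′) + (B + B′)            ≡⟨ cong (λ n → 4 * (c + c′) + n + (B + B′)) (length-++ S′) ⟨
    4 * (c + c′) + length (S′ ++ T′) + (B + B′)                  ∎)
    where
    open ≤-Reasoning
    arith : ∀ a b c d e f → (4 * a + b + c) + (4 * d + e + f) ≡ 4 * (a + d) + (b + e) + (c + f)
    arith = solve-∀

  -- Cancelling a pair lowers twice the length by 4 and raises `4 * c` by 4, so it leaves the defect
  -- unchanged.
  reducible-pairsRemoved : PairsRemoved S S′ → Reducible B S′ → Reducible B S
  reducible-pairsRemoved {S} {S′} {B} (c , t , e) (c′ , S″ , t′ , le) = c + c′ , S″ , ⟶-trans t t′ , (begin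
    2 * length S                            ≡⟨ cong (2 *_) e ⟩
    2 * (2 * c + length S′)                 ≡⟨ arith₁ c (length S′) ⟩
    4 * c + 2 * length S′                   ≤⟨ +-monoʳ-≤ (4 * c) le ⟩
    4 * c + (4 * c′ + length S″ + B)        ≡⟨ arith₂ c c′ (length S″) B ⟩
    4 * (c + c′) + length S″ + B            ∎)
    where
    open ≤-Reasoning
    arith₁ : ∀ a b → 2 * (2 * a + b) ≡ 4 * a + 2 * b
    arith₁ = solve-∀
    arith₂ : ∀ a b c d → 4 * a + (4 * b + c + d) ≡ 4 * (a + b) + c + d
    arith₂ = solve-∀

  split : ∀ S → All (λ v → P v ⊎ Q v) S → ∃[ S₁ ] ∃[ S₂ ] (S ↭ S₁ ++ S₂ × All P S₁ × All Q S₂)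
  split [] [] = [] , [] , ↭-refl , [] , []
  split (x ∷ S) (pq ∷ pqs) with split S pqs | pq
  ... | S₁ , S₂ , p , ps , qs | inj₁ px = x ∷ S₁ , S₂ , prep x p , px ∷ ps , qs
  ... | S₁ , S₂ , p , ps , qs | inj₂ qx =
    S₁ , x ∷ S₂ , ↭-trans (prep x p) (↭-sym (Permutation.shift x S₁ S₂)) , ps , qx ∷ qs

  cover-⊎ : Cover B P → Cover B′ Q → Cover (B + B′) (λ v → P v ⊎ Q v)
  cover-⊎ cP cQ S ps with S₁ , S₂ , p , ps₁ , ps₂ ← split S ps =
    reducible-↭ p (reducible-++ (cP S₁ ps₁) (cQ S₂ ps₂))

  cover-Any : {X : Set} {R : X → V r → Set} → (∀ x → Cover B (R x)) →
    (xs : List X) → Cover (length xs * B) (λ v → Any (λ x → R x v) xs)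
  cover-Any cR []       []      []       = 0 , [] , done ↭-refl , z≤n
  cover-Any cR (x ∷ xs) S       ps       = cover-⊎ (cR x) (cover-Any cR xs) S (All.map Any.toSum ps)

  -- Each zero is a zero-sum list by itself: it adds 2 on the left and gains 4 on the right.
  cover-𝟎 : Cover 0 (𝟎 ≡_)
  cover-𝟎 [] [] = 0 , [] , done ↭-refl , z≤n
  cover-𝟎 (x ∷ S) (refl ∷ ps) with c , S′ , t , le ← cover-𝟎 S ps =
    suc c , S′ , remove [ x ] (λ ()) (⊕-identityʳ x) ↭-refl t , (begin
    2 * suc (length S)               ≡⟨ *-suc 2 (length S) ⟩
    2 + 2 * length S                 ≤⟨ +-mono-≤ (m≤m+n 2 2) le ⟩
    4 + (4 * c + length S′ + 0)      ≡⟨ arith c (length S′) ⟩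
    4 * suc c + length S′ + 0        ∎)
    where
    open ≤-Reasoning
    arith : ∀ a b → 4 + (4 * a + b + 0) ≡ 4 * suc a + b + 0
    arith = solve-∀

  cover-point : ∀ x → Cover 1 (x ≡_)
  cover-point x S ps with removePairs ps
  ... | b , h = reducible-pairsRemoved h (small b)
    where
    small : ∀ b → Reducible 1 (parityPart b x)
    small false = 0 , _ , done ↭-refl , ≤ᵇ⇒≤ _ _ _
    small true  = 0 , _ , done ↭-refl , ≤ᵇ⇒≤ _ _ _

  OnLine : V r × V r → V r → Set
  OnLine (x , y) v = x ≡ v ⊎ y ≡ v ⊎ x ⊕ y ≡ v

  -- After cancelling pairs, each of the three vectors is left at most once. If all three are left
  -- they form one zero-sum list, and 2 · 3 = 4 · 1 + 0 + 2; if only n ≤ 2 are left they stay, and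
  -- 2n ≤ n + 2.
  cover-line : ∀ l → Cover 2 (OnLine l)
  cover-line (x , y) S ps
    with S₁ , S₂₃ , p , ps₁ , ps₂₃ ← split S ps
    with S₂ , S₃ , q , ps₂ , ps₃ ← split S₂₃ ps₂₃
    with b₁ , h₁ ← removePairs ps₁ | b₂ , h₂ ← removePairs ps₂ | b₃ , h₃ ← removePairs ps₃
    = reducible-↭ (↭-trans p (Permutation.++⁺ˡ S₁ q))
        (reducible-pairsRemoved (pairsRemoved-++ h₁ (pairsRemoved-++ h₂ h₃)) (small b₁ b₂ b₃))
    where
    small : ∀ a b c → Reducible 2 (parityPart a x ++ parityPart b y ++ parityPart c (x ⊕ y))
    small true  true  true  =
      1 , [] , remove (x ∷ y ∷ (x ⊕ y) ∷ []) (λ ()) line-sum ↭-refl (done ↭-refl) , ≤ᵇ⇒≤ _ _ _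
      where
      line-sum : x ⊕ (y ⊕ ((x ⊕ y) ⊕ 𝟎)) ≡ 𝟎
      line-sum = trans (cong (λ v → x ⊕ (y ⊕ v)) (⊕-identityʳ _)) (trans (sym (⊕-assoc x y _)) (⊕-self _))
    small false b     c     with b | c
    ... | false | false = 0 , _ , done ↭-refl , ≤ᵇ⇒≤ _ _ _
    ... | false | true  = 0 , _ , done ↭-refl , ≤ᵇ⇒≤ _ _ _
    ... | true  | false = 0 , _ , done ↭-refl , ≤ᵇ⇒≤ _ _ _
    ... | true  | true  = 0 , _ , done ↭-refl , ≤ᵇ⇒≤ _ _ _
    small true  false false = 0 , _ , done ↭-refl , ≤ᵇ⇒≤ _ _ _
    small true  false true  = 0 , _ , done ↭-refl , ≤ᵇ⇒≤ _ _ _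
    small true  true  false = 0 , _ , done ↭-refl , ≤ᵇ⇒≤ _ _ _

-- Line spreads

vectors : ∀ r → List (V r)
vectors zero    = [ [] ]
vectors (suc r) = map (false ∷_) (vectors r) ++ map (true ∷_) (vectors r)

∈-vectors : (v : V r) → v ∈ vectors r
∈-vectors []          = here refl
∈-vectors (false ∷ v) = ∈-++⁺ˡ (∈-map⁺ (false ∷_) (∈-vectors v))
∈-vectors (true ∷ v)  = ∈-++⁺ʳ _ (∈-map⁺ (true ∷_) (∈-vectors v))

length-vectors : ∀ r → length (vectors r) ≡ 2 ^ r
length-vectors zero    = refl
length-vectors (suc r) = begin
  length (map (false ∷_) (vectors r) ++ map (true ∷_) (vectors r))       ≡⟨ length-++ (map (false ∷_) (vectors r)) ⟩
  length (map (false ∷_) (vectors r)) + length (map (true ∷_) (vectors r)) ≡⟨ cong₂ _+_ (length-map _ (vectors r)) (length-map _ (vectors r)) ⟩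
  length (vectors r) + length (vectors r)                                ≡⟨ cong₂ _+_ (length-vectors r) (length-vectors r) ⟩
  2 ^ r + 2 ^ r                                                          ≡⟨ cong (λ n → 2 ^ r + n) (+-identityʳ (2 ^ r)) ⟨
  2 ^ suc r                                                              ∎
  where open ≡-Reasoning

-- α and 1 + α are both onto, so x ↦ {(x,01), (α x,10), (x ⊕ α x,11)}
-- gives 2^r lines covering F₂^{r+2} outside F₂^r × {00}.
record Orthomorphism (r : ℕ) : Set where
  field
    α α⁻¹ [1+α]⁻¹  : V r → V r
    α-inverse      : ∀ y → α (α⁻¹ y) ≡ y
    [1+α]-inverse  : ∀ y → [1+α]⁻¹ y ⊕ α ([1+α]⁻¹ y) ≡ y

orthomorphism₀ : Orthomorphism 0
orthomorphism₀ = record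
  { α = id ; α⁻¹ = id ; [1+α]⁻¹ = id ; α-inverse = λ _ → refl ; [1+α]-inverse = λ { [] → refl } }

-- Multiplication by t in F₂[t]/(t³+t+1).
orthomorphism₃ : Orthomorphism 3
orthomorphism₃ = record
  { α             = λ { (a ∷ b ∷ c ∷ []) → c ∷ (a xor c) ∷ b ∷ [] }
  ; α⁻¹           = λ { (a ∷ b ∷ c ∷ []) → (a xor b) ∷ c ∷ a ∷ [] }
  ; [1+α]⁻¹       = λ { (a ∷ b ∷ c ∷ []) → (b xor c) ∷ (a xor b) ∷ (a xor b xor c) ∷ [] }
  ; α-inverse     = λ { (false ∷ false ∷ c ∷ []) → refl
                      ; (false ∷ true  ∷ c ∷ []) → refl
                      ; (true  ∷ false ∷ c ∷ []) → refl
                      ; (true  ∷ true  ∷ c ∷ []) → refl }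
  ; [1+α]-inverse = λ { (false ∷ false ∷ false ∷ []) → refl
                      ; (false ∷ false ∷ true  ∷ []) → refl
                      ; (false ∷ true  ∷ false ∷ []) → refl
                      ; (false ∷ true  ∷ true  ∷ []) → refl
                      ; (true  ∷ false ∷ false ∷ []) → refl
                      ; (true  ∷ false ∷ true  ∷ []) → refl
                      ; (true  ∷ true  ∷ false ∷ []) → refl
                      ; (true  ∷ true  ∷ true  ∷ []) → refl }
  }

-- The new block is multiplication by a generator of F₄.
orthomorphism-step : Orthomorphism r → Orthomorphism (2 + r)
orthomorphism-step o = record
  { α             = λ { (a ∷ b ∷ x) → b ∷ (a xor b) ∷ α x }
  ; α⁻¹           = λ { (a ∷ b ∷ x) → (a xor b) ∷ a ∷ α⁻¹ x }
  ; [1+α]⁻¹       = λ { (a ∷ b ∷ x) → b ∷ (a xor b) ∷ [1+α]⁻¹ x }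
  ; α-inverse     = λ { (false ∷ false ∷ x) → cong (λ z → _ ∷ _ ∷ z) (α-inverse x)
                      ; (false ∷ true  ∷ x) → cong (λ z → _ ∷ _ ∷ z) (α-inverse x)
                      ; (true  ∷ false ∷ x) → cong (λ z → _ ∷ _ ∷ z) (α-inverse x)
                      ; (true  ∷ true  ∷ x) → cong (λ z → _ ∷ _ ∷ z) (α-inverse x) }
  ; [1+α]-inverse = λ { (false ∷ false ∷ x) → cong (λ z → _ ∷ _ ∷ z) ([1+α]-inverse x)
                      ; (false ∷ true  ∷ x) → cong (λ z → _ ∷ _ ∷ z) ([1+α]-inverse x)
                      ; (true  ∷ false ∷ x) → cong (λ z → _ ∷ _ ∷ z) ([1+α]-inverse x)
                      ; (true  ∷ true  ∷ x) → cong (λ z → _ ∷ _ ∷ z) ([1+α]-inverse x) }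
  }
  where open Orthomorphism o

record PartialSpread (r : ℕ) : Set where
  field
    lines   : List (V r × V r)
    points  : List (V r)
    covers  : ∀ v → 𝟎 ≡ v ⊎ Any (λ l → OnLine l v) lines ⊎ Any (_≡ v) points
    -- A partition of the nonzero vectors into lines would cost 2 · 2^r - 2. The constant 5 is
    -- chosen for the seven points in rank 3, where 3 · 7 = 2 · 8 + 5.
    cost    : 3 * (length lines * 2 + length points * 1) ≤ 2 * 2 ^ r + 5

spread₀ : PartialSpread 0
spread₀ = record { lines = [] ; points = [] ; covers = λ { [] → inj₁ refl } ; cost = z≤n }

-- The start for odd ranks. Any two lines of F₂³ share a nonzero vector, so disjoint lines are not
-- to be had, and single points are affordable.
spread₃ : PartialSpread 3
spread₃ = record
  { lines  = []
  ; points = List.drop 1 (vectors 3)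
  ; covers = λ v → nonzero (∈-vectors v)
  ; cost   = ≤ᵇ⇒≤ _ _ _
  }
  where
  nonzero : ∀ {v} → v ∈ vectors 3 →
    𝟎 ≡ v ⊎ Any (λ l → OnLine l v) [] ⊎ Any (_≡ v) (List.drop 1 (vectors 3))
  nonzero (here v≡𝟎) = inj₁ (sym v≡𝟎)
  nonzero (there v∈) = inj₂ (inj₂ (Any.map sym v∈))

-- The old cover serves the vectors that begin with 00. The 2^r new lines add 6 · 2^r to the cost,
-- exactly the growth of 2 · 2^r from rank r to r + 2, so the slack stays at 5.
spread-step : Orthomorphism r → PartialSpread r → PartialSpread (2 + r)
spread-step {r} o s = record
  { lines  = map (λ { (x , y) → embed x , embed y }) lines ++ map newLine (vectors r)
  ; points = map embed points
  ; covers = covers′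
  ; cost   = begin
      3 * (length (map _ lines ++ map newLine (vectors r)) * 2 + length (map embed points) * 1)
        ≡⟨ cong₂ (λ m n → 3 * (m * 2 + n * 1))
             (trans (length-++ (map _ lines))
               (cong₂ _+_ (length-map _ lines) (trans (length-map newLine (vectors r)) (length-vectors r))))
             (length-map embed points) ⟩
      3 * ((length lines + 2 ^ r) * 2 + length points * 1)
        ≡⟨ arith₁ (length lines) (2 ^ r) (length points) ⟩
      3 * (length lines * 2 + length points * 1) + 6 * 2 ^ r
        ≤⟨ +-monoˡ-≤ (6 * 2 ^ r) cost ⟩
      2 * 2 ^ r + 5 + 6 * 2 ^ r
        ≡⟨ arith₂ (2 ^ r) ⟩
      2 * 2 ^ (2 + r) + 5 ∎
  }
  where
  open Orthomorphism o
  open PartialSpread s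
  open ≤-Reasoning

  arith₁ : ∀ a b c → 3 * ((a + b) * 2 + c * 1) ≡ 3 * (a * 2 + c * 1) + 6 * b
  arith₁ = solve-∀
  arith₂ : ∀ a → 2 * a + 5 + 6 * a ≡ 2 * (2 * (2 * a)) + 5
  arith₂ = solve-∀

  embed : V r → V (2 + r)
  embed x = false ∷ false ∷ x

  newLine : V r → V (2 + r) × V (2 + r)
  newLine x = (false ∷ true ∷ x) , (true ∷ false ∷ α x)

  onLine-embed : ∀ {l v} → OnLine l v → OnLine (embed (proj₁ l) , embed (proj₂ l)) (embed v)
  onLine-embed = Sum.map (cong embed) (Sum.map (cong embed) (cong embed))

  onNewLine : ∀ {v} x → OnLine (newLine x) v →
    Any (λ l → OnLine l v) (map (λ { (x , y) → embed x , embed y }) lines ++ map newLine (vectors r))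
  onNewLine x p = Any.++⁺ʳ _ (Any.map⁺ (Any.map (λ { refl → p }) (∈-vectors x)))

  covers′ : ∀ v → 𝟎 ≡ v
    ⊎ Any (λ l → OnLine l v) (map (λ { (x , y) → embed x , embed y }) lines ++ map newLine (vectors r))
    ⊎ Any (_≡ v) (map embed points)
  covers′ (false ∷ false ∷ x) =
    Sum.map (cong embed)
      (Sum.map (λ p → Any.++⁺ˡ (Any.map⁺ (Any.map onLine-embed p))) (λ p → Any.map⁺ (Any.map (cong embed) p)))
      (covers x)
  covers′ (false ∷ true ∷ x)  = inj₂ (inj₁ (onNewLine x (inj₁ refl)))
  covers′ (true ∷ false ∷ x)  =
    inj₂ (inj₁ (onNewLine (α⁻¹ x) (inj₂ (inj₁ (cong (λ z → true ∷ false ∷ z) (α-inverse x))))))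
  covers′ (true ∷ true ∷ x)   =
    inj₂ (inj₁ (onNewLine ([1+α]⁻¹ x) (inj₂ (inj₂ (cong (λ z → true ∷ true ∷ z) ([1+α]-inverse x))))))

-- Induction in steps of two, carrying the orthomorphism that the next step needs. Odd ranks start
-- at 3 because rank 1 has no orthomorphism: if α is onto F₂, then 1 + α is constant.
partialSpread : 2 ≤ r → Orthomorphism r × PartialSpread r
partialSpread {1}                       (s≤s ())
partialSpread {2}                       _ = orthomorphism-step orthomorphism₀ , spread-step orthomorphism₀ spread₀
partialSpread {3}                       _ = orthomorphism₃ , spread₃
partialSpread {suc (suc r@(suc (suc _)))} _ with o , s ← partialSpread {r} (s≤s (s≤s z≤n)) =
  orthomorphism-step o , spread-step o s

reducible : 2 ≤ r → ∃[ B ] (3 * B ≤ 2 * 2 ^ r + 5 × (∀ (S : List (V r)) → Reducible B S))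
reducible 2≤r = _ , cost , λ S →
  cover-⊎ cover-𝟎 (cover-⊎ (cover-Any cover-line lines) (cover-Any cover-point points)) S (All.universal covers S)
  where open PartialSpread (proj₂ (partialSpread 2≤r))

-- Short zero-sum subsequences

select₁ : ∀ {A : Set} (xs : List A) (i : Fin (length xs)) → ∃[ zs ] xs ↭ List.lookup xs i ∷ zs
select₁ (x ∷ xs) zero    = xs , ↭-refl
select₁ (x ∷ xs) (suc i) with zs , p ← select₁ xs i = x ∷ zs , ↭-trans (prep x p) (swap x _ ↭-refl)

select₂ : ∀ {A : Set} (xs : List A) (i j : Fin (length xs)) → i ≢ j →
  ∃[ zs ] xs ↭ List.lookup xs i ∷ List.lookup xs j ∷ zs
select₂ (x ∷ xs) zero    zero    i≢j = contradiction refl i≢j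
select₂ (x ∷ xs) zero    (suc j) i≢j with zs , p ← select₁ xs j = zs , prep x p
select₂ (x ∷ xs) (suc i) zero    i≢j with zs , p ← select₁ xs i = zs , ↭-trans (prep x p) (swap x _ ↭-refl)
select₂ (x ∷ xs) (suc i) (suc j) i≢j with zs , p ← select₂ xs i j (i≢j ∘ cong suc) =
  x ∷ zs , ↭-trans (prep x p) (↭-sym (Permutation.shift x (_ ∷ _ ∷ []) zs))

-- The position in the list of all vectors, which brings sums into the form that `pigeonhole`
-- expects.
code : V r → Fin (length (vectors r))
code v = Any.index (∈-vectors v)

code-injective : {v w : V r} → code v ≡ code w → v ≡ w
code-injective {r} {v} {w} e = begin
  v                              ≡⟨ Any.lookup-index (∈-vectors v) ⟩
  List.lookup (vectors r) (code v) ≡⟨ cong (List.lookup (vectors r)) e ⟩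
  List.lookup (vectors r) (code w) ≡⟨ Any.lookup-index (∈-vectors w) ⟨
  w                              ∎
  where open ≡-Reasoning

HasShortZeroSum : List (V r) → Set
HasShortZeroSum S = ∃[ T ] ∃[ R ] (T ≢ [] × ⨁ T ≡ 𝟎 × length T ≤ 4 × S ↭ T ++ R)

quad-zeroSum : {x y x′ y′ : V r} → x ⊕ y ≡ x′ ⊕ y′ → ⨁ (x ∷ x′ ∷ y ∷ y′ ∷ []) ≡ 𝟎
quad-zeroSum {x = x} {y} {x′} {y′} e = begin
  ⨁ (x ∷ x′ ∷ y ∷ y′ ∷ [])              ≡⟨ ⨁-↭ (prep x (swap x′ y (↭-refl {x = [ y′ ]}))) ⟩
  ⨁ (x ∷ y ∷ x′ ∷ y′ ∷ [])              ≡⟨ ⨁-++ (x ∷ y ∷ []) (x′ ∷ y′ ∷ []) ⟩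
  x ⊕ (y ⊕ 𝟎) ⊕ (x′ ⊕ (y′ ⊕ 𝟎))         ≡⟨ cong₂ (λ v w → x ⊕ v ⊕ (x′ ⊕ w)) (⊕-identityʳ y) (⊕-identityʳ y′) ⟩
  x ⊕ y ⊕ (x′ ⊕ y′)                     ≡⟨ cong (_⊕ (x′ ⊕ y′)) e ⟩
  x′ ⊕ y′ ⊕ (x′ ⊕ y′)                   ≡⟨ ⊕-self (x′ ⊕ y′) ⟩
  𝟎                                     ∎
  where open ≡-Reasoning

-- There are more pairs of positions than vectors, so two distinct pairs have the same sum. If they
-- share a position, cancellation leaves two equal terms; otherwise the four terms sum to zero.
-- Taking the two entries from separate lists keeps the four positions distinct.
hasShortZeroSum-++ : (X Y : List (V r)) → 2 ^ r < length X * length Y → HasShortZeroSum (X ++ Y)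
hasShortZeroSum-++ {r} X Y 2^r<
  with i , j , i<j , e ← pigeonhole (subst (_< length X * length Y) (sym (length-vectors r)) 2^r<)
         -- `Fin.remQuot` reads an index below the product of the lengths as a pair of positions.
         (λ n → code (List.lookup X (proj₁ (Fin.remQuot {length X} (length Y) n))
                    ⊕ List.lookup Y (proj₂ (Fin.remQuot {length X} (length Y) n))))
  = collision _ _ _ _ (λ { (e₁ , e₂) → Fin.<⇒≢ i<j (begin
      i                                                            ≡⟨ Fin.combine-remQuot {length X} (length Y) i ⟨
      Fin.combine (proj₁ (Fin.remQuot {length X} (length Y) i)) _  ≡⟨ cong₂ Fin.combine e₁ e₂ ⟩
      Fin.combine (proj₁ (Fin.remQuot {length X} (length Y) j)) _  ≡⟨ Fin.combine-remQuot {length X} (length Y) j ⟩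
      j                                                            ∎) })
      (code-injective e)
  where
  open ≡-Reasoning
  collision : ∀ a b a′ b′ → ¬ (a ≡ a′ × b ≡ b′) →
    List.lookup X a ⊕ List.lookup Y b ≡ List.lookup X a′ ⊕ List.lookup Y b′ → HasShortZeroSum (X ++ Y)
  collision a b a′ b′ ≢ e with a Fin.≟ a′ | b Fin.≟ b′
  ... | yes refl | yes refl = contradiction (refl , refl) ≢
  ... | yes refl | no b≢b′ with Z , p ← select₂ Y b b′ b≢b′ =
    _ ∷ _ ∷ [] , X ++ Z , (λ ()) , pair-zeroSum (⊕-cancelˡ _ _ _ e) , m≤m+n 2 2 ,
    ↭-trans (Permutation.++⁺ˡ X p) (shifts X (_ ∷ _ ∷ []))
  ... | no a≢a′ | yes refl with Z , p ← select₂ X a a′ a≢a′ =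
    _ ∷ _ ∷ [] , Z ++ Y , (λ ()) , pair-zeroSum (⊕-cancelʳ _ _ _ e) , m≤m+n 2 2 , Permutation.++⁺ʳ Y p
  ... | no a≢a′ | no b≢b′ with Z , p ← select₂ X a a′ a≢a′ | W , q ← select₂ Y b b′ b≢b′ =
    _ ∷ _ ∷ _ ∷ _ ∷ [] , Z ++ W , (λ ()) , quad-zeroSum e , ≤-refl ,
    ↭-trans (Permutation.++⁺ p q) (prep _ (prep _ (shifts Z (_ ∷ _ ∷ []))))

hasShortZeroSum : ∀ q (S : List (V r)) → 2 ^ r < q * q → 2 * q ≤ length S → HasShortZeroSum S
hasShortZeroSum {r} q S 2^r<q² 2q≤S = subst HasShortZeroSum (List.take++drop≡id q S)
  (hasShortZeroSum-++ (List.take q S) (List.drop q S) (≤-trans 2^r<q² (*-mono-≤ q≤take q≤drop)))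
  where
  open ≤-Reasoning
  q≤take : q ≤ length (List.take q S)
  q≤take = begin
    q                       ≡⟨ m≤n⇒m⊓n≡m (≤-trans (m≤m+n q (q + 0)) 2q≤S) ⟨
    q ⊓ length S            ≡⟨ List.length-take q S ⟨
    length (List.take q S)  ∎
  q≤drop : q ≤ length (List.drop q S)
  q≤drop = begin
    q                       ≡⟨ m+n∸n≡m q q ⟨
    q + q ∸ q               ≤⟨ ∸-monoˡ-≤ q (≤-trans (≤-reflexive (cong (λ n → q + n) (sym (+-identityʳ q)))) 2q≤S) ⟩
    length S ∸ q            ≡⟨ List.length-drop q S ⟨
    length (List.drop q S)  ∎

removeShort : ∀ q → 2 ^ r < q * q → (S : List (V r)) →
  ∃[ c ] ∃[ S′ ] (S ⟶[ c ] S′ × length S < 4 * c + 2 * q)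
removeShort {r} q 2^r<q² S = go (length S) S ≤-refl
  where
  open ≤-Reasoning
  arith : ∀ c n → 4 + (4 * c + n) ≡ 4 * suc c + n
  arith = solve-∀

  -- `n` is fuel that bounds the length; it can drop by one at each removal because the removed list
  -- is non-empty.
  go : ∀ n (S : List (V r)) → length S ≤ n → ∃[ c ] ∃[ S′ ] (S ⟶[ c ] S′ × length S < 4 * c + 2 * q)
  go n S ≤n with 2 * q ≤? length S
  ... | no 2q≰S  = 0 , S , done ↭-refl , ≰⇒> 2q≰S
  ... | yes 2q≤S with hasShortZeroSum q S 2^r<q² 2q≤S
  ...   | [] , _ , T≢[] , _ = contradiction refl T≢[]
  ...   | T@(x ∷ T′) , R , T≢[] , z , T≤4 , p with n | subst (_≤ n) (trans (↭-length p) (length-++ T)) ≤n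
  ...     | suc n | s≤s ≤n′ with c , S′ , t , R< ← go n R (≤-trans (m≤n+m (length R) (length T′)) ≤n′) =
    suc c , S′ , remove T T≢[] z p t , (begin-strict
    length S                   ≡⟨ trans (↭-length p) (length-++ T) ⟩
    length T + length R        <⟨ +-mono-≤-< T≤4 R< ⟩
    4 + (4 * c + 2 * q)        ≡⟨ arith c (2 * q) ⟩
    4 * suc c + 2 * q          ∎)

-- Here p is 2^r, l and l′ are the lengths before and after the covering stage, and c₁, c₂ count the
-- removals of the two stages. Chaining the bounds gives 2l < 4(c₁ + c₂) + 2q + B, and with B ≤ 2N +
-- 2 and 2(N + q + 2k) ≤ 2l + 2 this yields 4k < 4(c₁ + c₂ + 1).
countBound : ∀ p N q k B c₁ c₂ l l′ → p ≤ 1 + 3 * N → 3 * B ≤ 2 * p + 5 → N + q + 2 * k ≤ suc l →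
  2 * l ≤ 4 * c₁ + l′ + B → l′ < 4 * c₂ + 2 * q → k ≤ c₁ + c₂
countBound p N q k B c₁ c₂ l l′ p≤ 3B≤ len le₁ le₂ = ≤-pred (*-cancelˡ-< 4 k (suc (c₁ + c₂)) 4k<)
  where
  open ≤-Reasoning

  arith₁ : ∀ n → 2 * (1 + 3 * n) + 5 + 2 ≡ 3 * (2 * n + 3)
  arith₁ = solve-∀
  arith₂ : ∀ k n q → 4 * k + (2 * n + 2 * q + 1) ≡ 2 * (n + q + 2 * k) + 1
  arith₂ = solve-∀
  arith₃ : ∀ l → 2 * suc l + 1 ≡ 2 * l + 3
  arith₃ = solve-∀
  arith₄ : ∀ c d q b → suc (4 * c + (4 * d + 2 * q) + b + 2) ≡ 4 * (c + d) + 2 * q + (suc b + 2)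
  arith₄ = solve-∀
  arith₅ : ∀ c q n → 4 * c + 2 * q + (2 * n + 3 + 2) ≡ 4 * suc c + (2 * n + 2 * q + 1)
  arith₅ = solve-∀

  -- The hypotheses give 3B ≤ 6N + 7, so rounding to integers absorbs the slack of the cover.
  B< : B < 2 * N + 3
  B< = *-cancelˡ-< 3 B (2 * N + 3) (begin-strict
    3 * B                            ≤⟨ 3B≤ ⟩
    2 * p + 5                        ≤⟨ +-monoˡ-≤ 5 (*-monoʳ-≤ 2 p≤) ⟩
    2 * (1 + 3 * N) + 5              <⟨ m<m+n _ z<s ⟩
    2 * (1 + 3 * N) + 5 + 2          ≡⟨ arith₁ N ⟩
    3 * (2 * N + 3)                  ∎)

  4k< : 4 * k < 4 * suc (c₁ + c₂)
  4k< = +-cancelʳ-< (2 * N + 2 * q + 1) _ _ (begin-strict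
    4 * k + (2 * N + 2 * q + 1)                ≡⟨ arith₂ k N q ⟩
    2 * (N + q + 2 * k) + 1                    ≤⟨ +-monoˡ-≤ 1 (*-monoʳ-≤ 2 len) ⟩
    2 * suc l + 1                              ≡⟨ arith₃ l ⟩
    2 * l + 3                                  ≤⟨ +-monoˡ-≤ 3 le₁ ⟩
    4 * c₁ + l′ + B + 3                        <⟨ +-monoˡ-< 3 (+-monoˡ-< B (+-monoʳ-< (4 * c₁) le₂)) ⟩
    4 * c₁ + (4 * c₂ + 2 * q) + B + 3          ≡⟨ +-suc _ 2 ⟩
    suc (4 * c₁ + (4 * c₂ + 2 * q) + B + 2)    ≡⟨ arith₄ c₁ c₂ q B ⟩
    4 * (c₁ + c₂) + 2 * q + (suc B + 2)        ≤⟨ +-monoʳ-≤ (4 * (c₁ + c₂) + 2 * q) (+-monoˡ-≤ 2 B<) ⟩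
    4 * (c₁ + c₂) + 2 * q + (2 * N + 3 + 2)    ≡⟨ arith₅ (c₁ + c₂) q N ⟩
    4 * suc (c₁ + c₂) + (2 * N + 2 * q + 1)    ∎)

-- The successor on the right matters: length N + q + 2k - 1 already suffices, one less than the
-- value of D_k to be refuted.
manyZeroSums : 2 ≤ r → ∀ N q k → 2 ^ r ≤ 1 + 3 * N → 2 ^ r < q * q → (S : List (V r)) →
  N + q + 2 * k ≤ suc (length S) → HasDisjointZeroSums (vectorGroup r) k S
manyZeroSums {r} 2≤r N q k 2^r≤ 2^r<q² S len =
  let B  , 3B≤ , red      = reducible 2≤r
      c₁ , S′ , t₁ , le₁  = red S
      c₂ , S″ , t₂ , le₂  = removeShort q 2^r<q² S′
  in ⟶⇒hasDisjointZeroSums (⟶-trans t₁ t₂)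
       (countBound (2 ^ r) N q k B c₁ c₂ (length S) (length S′) 2^r≤ 3B≤ len le₁ le₂)

-- A long sequence with few disjoint zero-sum subsequences

module _ {A : Set} (w : A → ℕ) where

  weight : List A → ℕ
  weight S = sum (map w S)

  weight-++ : ∀ S T → weight (S ++ T) ≡ weight S + weight T
  weight-++ S T = trans (cong sum (List.map-++ w S T)) (sum-++ (map w S) (map w T))

  weight-↭ : ∀ {S T} → S ↭ T → weight S ≡ weight T
  weight-↭ p = sum-↭ (Permutation.map⁺ w p)

weight-map : {A B : Set} (w : B → ℕ) (f : A → B) → ∀ S → weight w (map f S) ≡ weight (w ∘ f) S
weight-map w f S = cong sum (sym (List.map-∘ S))

weight-0 : {A : Set} (S : List A) → weight (λ _ → 0) S ≡ 0
weight-0 []      = refl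
weight-0 (_ ∷ S) = weight-0 S

-- The Kronecker delta, valued in ℕ so that multiplicities are sums, and recursive on bits so that
-- it computes on lists built by prefixing a bit.
δ : V r → V r → ℕ
δ []          []          = 1
δ (false ∷ x) (false ∷ y) = δ x y
δ (false ∷ x) (true  ∷ y) = 0
δ (true  ∷ x) (false ∷ y) = 0
δ (true  ∷ x) (true  ∷ y) = δ x y

δ-refl : (x : V r) → δ x x ≡ 1
δ-refl []          = refl
δ-refl (false ∷ x) = δ-refl x
δ-refl (true  ∷ x) = δ-refl x

δ-sym : (x y : V r) → δ x y ≡ δ y x
δ-sym []          []          = refl
δ-sym (false ∷ x) (false ∷ y) = δ-sym x y
δ-sym (false ∷ x) (true  ∷ y) = refl
δ-sym (true  ∷ x) (false ∷ y) = refl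
δ-sym (true  ∷ x) (true  ∷ y) = δ-sym x y

mult : V r → List (V r) → ℕ
mult x = weight (δ x)

mult-∷ : ∀ a (x : V r) S T → mult (a ∷ x) (map (false ∷_) S ++ map (true ∷_) T) ≡ (if a then mult x T else mult x S)
mult-∷ a x S T = trans (weight-++ (δ (a ∷ x)) (map (false ∷_) S) (map (true ∷_) T))
  (trans (cong₂ _+_ (weight-map (δ (a ∷ x)) (false ∷_) S) (weight-map (δ (a ∷ x)) (true ∷_) T)) (select a))
  where
  select : ∀ a → weight (λ y → δ (a ∷ x) (false ∷ y)) S + weight (λ y → δ (a ∷ x) (true ∷ y)) T
         ≡ (if a then mult x T else mult x S)
  select false = trans (cong (λ n → mult x S + n) (weight-0 T)) (+-identityʳ _)
  select true  = cong (_+ mult x T) (weight-0 S)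

mult-vectors : (x : V r) → mult x (vectors r) ≡ 1
mult-vectors {zero}  []          = refl
mult-vectors {suc r} (false ∷ x) = trans (mult-∷ false x (vectors r) (vectors r)) (mult-vectors x)
mult-vectors {suc r} (true  ∷ x) = trans (mult-∷ true x (vectors r) (vectors r)) (mult-vectors x)

nonzeros : ∀ r → List (V r)
nonzeros zero    = []
nonzeros (suc r) = map (false ∷_) (nonzeros r) ++ map (true ∷_) (vectors r)

vectors≡𝟎∷nonzeros : ∀ r → vectors r ≡ 𝟎 ∷ nonzeros r
vectors≡𝟎∷nonzeros zero    = refl
vectors≡𝟎∷nonzeros (suc r) = cong (λ S → map (false ∷_) S ++ map (true ∷_) (vectors r)) (vectors≡𝟎∷nonzeros r)

length-nonzeros : ∀ r → suc (length (nonzeros r)) ≡ 2 ^ r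
length-nonzeros r = trans (cong length (sym (vectors≡𝟎∷nonzeros r))) (length-vectors r)

mult-nonzeros : (x : V r) → δ x 𝟎 + mult x (nonzeros r) ≡ 1
mult-nonzeros {r} x = trans (cong (mult x) (sym (vectors≡𝟎∷nonzeros r))) (mult-vectors x)

odd : ℕ → Bool
odd zero    = false
odd (suc n) = not (odd n)

odd-double : ∀ n → odd (2 * n) ≡ false
odd-double zero    = refl
odd-double (suc n) = trans (cong odd (*-suc 2 n)) (trans (not-involutive _) (odd-double n))

⨁-map-false : (S : List (V r)) → ⨁ (map (false ∷_) S) ≡ false ∷ ⨁ S
⨁-map-false []      = refl
⨁-map-false (x ∷ S) = cong ((false ∷ x) ⊕_) (⨁-map-false S)

⨁-map-true : (S : List (V r)) → ⨁ (map (true ∷_) S) ≡ odd (length S) ∷ ⨁ S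
⨁-map-true []      = refl
⨁-map-true (x ∷ S) = cong ((true ∷ x) ⊕_) (⨁-map-true S)

copies : ℕ → V r → List (V r)
copies zero    g = []
copies (suc m) g = g ∷ g ∷ copies m g

length-copies : ∀ m (g : V r) → length (copies m g) ≡ 2 * m
length-copies zero    g = refl
length-copies (suc m) g = trans (cong (λ n → 2 + n) (length-copies m g)) (sym (*-suc 2 m))

mult-copies : ∀ x m (g : V r) → mult x (copies m g) ≡ 2 * m * δ x g
mult-copies x zero    g = refl
mult-copies x (suc m) g = begin
  δ x g + (δ x g + mult x (copies m g))  ≡⟨ cong (λ n → δ x g + (δ x g + n)) (mult-copies x m g) ⟩
  δ x g + (δ x g + 2 * m * δ x g)        ≡⟨ arith m (δ x g) ⟩
  2 * suc m * δ x g                      ∎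
  where
  open ≡-Reasoning
  arith : ∀ m d → d + (d + 2 * m * d) ≡ 2 * suc m * d
  arith = solve-∀

⨁-copies : ∀ m (g : V r) → ⨁ (copies m g) ≡ 𝟎
⨁-copies zero    g = refl
⨁-copies (suc m) g = begin
  g ⊕ (g ⊕ ⨁ (copies m g))  ≡⟨ ⊕-assoc g g _ ⟨
  g ⊕ g ⊕ ⨁ (copies m g)    ≡⟨ cong₂ _⊕_ (⊕-self g) (⨁-copies m g) ⟩
  𝟎 ⊕ 𝟎                     ≡⟨ ⊕-identityˡ 𝟎 ⟩
  𝟎                         ∎
  where open ≡-Reasoning

-- g weighs 3 and every other element 2, so that the one repeatable pair (g , g)
-- weighs 6, as much as three distinct elements.
module _ {r : ℕ} (g : V r) (m : ℕ) where

  heaviness : List (V r) → ℕ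
  heaviness = weight (λ v → 2 + δ g v)

  -- Zero does not occur and only `g` may repeat. Both conditions are upper bounds on
  -- multiplicities, so they pass to sublists.
  Sparse : List (V r) → Set
  Sparse S = mult 𝟎 S ≤ 0 × (∀ x → mult x S ≤ 1 + 2 * m * δ x g)

  sparse-++⁻ˡ : ∀ S T → Sparse (S ++ T) → Sparse S
  sparse-++⁻ˡ S T (z , s) = ≤-trans (sub 𝟎) z , λ x → ≤-trans (sub x) (s x)
    where
    sub : ∀ x → mult x S ≤ mult x (S ++ T)
    sub x = ≤-trans (m≤m+n _ _) (≤-reflexive (sym (weight-++ (δ x) S T)))

  sparse-++⁻ʳ : ∀ S T → Sparse (S ++ T) → Sparse T
  sparse-++⁻ʳ S T (z , s) = ≤-trans (sub 𝟎) z , λ x → ≤-trans (sub x) (s x)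
    where
    sub : ∀ x → mult x T ≤ mult x (S ++ T)
    sub x = ≤-trans (m≤n+m _ _) (≤-reflexive (sym (weight-++ (δ x) S T)))

  -- A single term would be zero, which is excluded. Two terms are equal, hence both are `g` and
  -- weigh 3 + 3. Three or more terms weigh at least 2 each.
  heaviness-zeroSum : ∀ T → T ≢ [] → ⨁ T ≡ 𝟎 → Sparse T → 6 ≤ heaviness T
  heaviness-zeroSum []          T≢[] _ _ = contradiction refl T≢[]
  heaviness-zeroSum (x ∷ [])    _ z (sp , _) with trans (sym (⊕-identityʳ x)) z
  ... | refl with () ← subst (λ n → n + 0 ≤ 0) (δ-refl x) sp
  heaviness-zeroSum (x ∷ y ∷ []) _ z (_ , sp)
    with refl ← ⊕≡𝟎⇒≡ x y (trans (cong (x ⊕_) (sym (⊕-identityʳ y))) z) = pair (sp x)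
    where
    pair : mult x (x ∷ x ∷ []) ≤ 1 + 2 * m * δ x g → 6 ≤ heaviness (x ∷ x ∷ [])
    pair le rewrite δ-refl x | δ-sym x g with δ g x
    ... | zero  with s≤s () ← subst (λ n → 2 ≤ 1 + n) (*-zeroʳ (2 * m)) le
    ... | suc d = +-mono-≤ {3} {2 + suc d} (s≤s (s≤s (s≤s z≤n))) (s≤s (s≤s (s≤s z≤n)))
  heaviness-zeroSum (x ∷ y ∷ z ∷ T) _ _ _ = heavy x (heavy y (heavy z z≤n))
    where
    heavy : ∀ v {a b} → a ≤ b → 2 + a ≤ 2 + δ g v + b
    heavy v a≤b = s≤s (s≤s (≤-trans a≤b (m≤n+m _ (δ g v))))

  heaviness-concat : ∀ Ts → All (λ T → T ≢ [] × ⨁ T ≡ 𝟎) Ts → Sparse (concat Ts) → length Ts * 6 ≤ heaviness (concat Ts)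
  heaviness-concat []       []             sp = z≤n
  heaviness-concat (T ∷ Ts) ((n , z) ∷ zs) sp =
    ≤-trans
      (+-mono-≤ (heaviness-zeroSum T n z (sparse-++⁻ˡ T (concat Ts) sp))
                (heaviness-concat Ts zs (sparse-++⁻ʳ T (concat Ts) sp)))
      (≤-reflexive (sym (weight-++ _ T (concat Ts))))

  heaviness-expand : ∀ S → heaviness S ≡ 2 * length S + mult g S
  heaviness-expand []      = refl
  heaviness-expand (x ∷ S) = trans (cong (λ n → 2 + δ g x + n) (heaviness-expand S)) (arith (δ g x) (length S) (mult g S))
    where
    arith : ∀ d l n → 2 + d + (2 * l + n) ≡ 2 * suc l + (d + n)
    arith = solve-∀

  heaviness-nonempty : ∀ R → R ≢ [] → 2 ≤ heaviness R
  heaviness-nonempty []      R≢[] = contradiction refl R≢[]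
  heaviness-nonempty (x ∷ R) _    = s≤s (s≤s z≤n)

  -- Each zero-sum list takes weight 6 from the total. As the whole sum is nonzero, the remainder is
  -- non-empty and takes at least 2 more.
  fewZeroSums : ∀ {k} S → Sparse S → ⨁ S ≢ 𝟎 → HasDisjointZeroSums (vectorGroup r) k S →
    k * 6 + 2 ≤ 2 * length S + mult g S
  fewZeroSums {k} S (z , sp) ⨁S≢𝟎 (Ts , R , refl , zs , p) = begin
    length Ts * 6 + 2                  ≤⟨ +-mono-≤ (heaviness-concat Ts zs (sparse-++⁻ˡ (concat Ts) R sparse)) (heaviness-nonempty R R≢[]) ⟩
    heaviness (concat Ts) + heaviness R ≡⟨ weight-++ _ (concat Ts) R ⟨
    heaviness (concat Ts ++ R)         ≡⟨ weight-↭ _ S↭ ⟨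
    heaviness S                        ≡⟨ heaviness-expand S ⟩
    2 * length S + mult g S            ∎
    where
    open ≤-Reasoning
    S↭ : S ↭ concat Ts ++ R
    S↭ = ↭ₛ⇒↭ p

    sparse : Sparse (concat Ts ++ R)
    sparse = subst (_≤ 0) (weight-↭ (δ 𝟎) S↭) z , λ x → subst (_≤ _) (weight-↭ (δ x) S↭) (sp x)

    R≢[] : R ≢ []
    R≢[] refl = ⨁S≢𝟎 (trans (⨁-↭ S↭) (trans (cong ⨁ (List.++-identityʳ (concat Ts))) (⨁-concat zs)))

e₁ : V (suc r)
e₁ = true ∷ 𝟎

-- With `e₁` as the repeated element, the vectors other than `𝟎` and `e₁` are those with a nonzero
-- tail: two copies of `nonzeros r`, one for each leading bit.
extremal : ∀ r → ℕ → List (V (suc r))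
extremal r m = (map (false ∷_) (nonzeros r) ++ map (true ∷_) (nonzeros r)) ++ copies m e₁

length-extremal : ∀ r m → 2 + length (extremal r m) ≡ 2 ^ suc r + 2 * m
length-extremal r m = begin
  2 + length (extremal r m)
    ≡⟨ cong (λ n → 2 + n) (trans (length-++ (map _ (nonzeros r) ++ map _ (nonzeros r)))
         (cong₂ _+_ (trans (length-++ (map _ (nonzeros r)))
                      (cong₂ _+_ (length-map _ (nonzeros r)) (length-map _ (nonzeros r))))
                    (length-copies m e₁))) ⟩
  2 + (l + l + 2 * m)           ≡⟨ arith l (2 * m) ⟩
  2 * suc l + 2 * m             ≡⟨ cong (λ n → 2 * n + 2 * m) (length-nonzeros r) ⟩
  2 ^ suc r + 2 * m             ∎
  where
  open ≡-Reasoning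
  l = length (nonzeros r)
  arith : ∀ l n → 2 + (l + l + n) ≡ 2 * suc l + n
  arith = solve-∀

mult-extremal : ∀ m a (x : V r) → mult (a ∷ x) (extremal r m) ≡ mult x (nonzeros r) + 2 * m * δ (a ∷ x) e₁
mult-extremal {r} m a x =
  trans (weight-++ (δ (a ∷ x)) (map (false ∷_) (nonzeros r) ++ map (true ∷_) (nonzeros r)) (copies m e₁))
    (cong₂ _+_ (trans (mult-∷ a x (nonzeros r) (nonzeros r)) (if-same a)) (mult-copies (a ∷ x) m e₁))
  where
  if-same : ∀ a {n : ℕ} → (if a then n else n) ≡ n
  if-same false = refl
  if-same true  = refl

mult-𝟎-nonzeros : ∀ r → mult 𝟎 (nonzeros r) ≡ 0
mult-𝟎-nonzeros r = suc-injective (trans (cong (_+ mult 𝟎 (nonzeros r)) (sym (δ-refl (𝟎 {r})))) (mult-nonzeros (𝟎 {r})))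

mult-e₁-extremal : ∀ r m → mult e₁ (extremal r m) ≡ 2 * m
mult-e₁-extremal r m = trans (mult-extremal m true (𝟎 {r}))
  (trans (cong₂ (λ a b → a + 2 * m * b) (mult-𝟎-nonzeros r) (δ-refl (𝟎 {r}))) (*-identityʳ (2 * m)))

extremal-sparse : ∀ r m → Sparse e₁ m (extremal r m)
extremal-sparse r m =
  ≤-reflexive (trans (mult-extremal m false (𝟎 {r})) (trans (cong (_+ 2 * m * 0) (mult-𝟎-nonzeros r)) (*-zeroʳ (2 * m)))) ,
  λ { (a ∷ x) → ≤-trans (≤-reflexive (mult-extremal m a x))
        (+-monoˡ-≤ _ (≤-trans (m≤n+m _ (δ x 𝟎)) (≤-reflexive (mult-nonzeros x)))) }

-- The tails of the two halves cancel, and the leading bit of the sum is the parity of the 2^(r+1) -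
-- 1 vectors that begin with `true`. This number is odd because the tails have positive rank.
⨁-extremal : ∀ r m → ⨁ (extremal (suc r) m) ≢ 𝟎
⨁-extremal r m e = contradiction (trans (sym odd-l) (cong Vec.head (trans (sym ⨁S≡) e))) λ ()
  where
  open ≡-Reasoning
  S = nonzeros (suc r)

  ⨁S≡ : ⨁ (extremal (suc r) m) ≡ odd (length S) ∷ 𝟎
  ⨁S≡ = begin
    ⨁ (extremal (suc r) m)
      ≡⟨ ⨁-++ (map (false ∷_) S ++ map (true ∷_) S) (copies m e₁) ⟩
    ⨁ (map (false ∷_) S ++ map (true ∷_) S) ⊕ ⨁ (copies m e₁)
      ≡⟨ cong₂ _⊕_ (⨁-++ (map (false ∷_) S) (map (true ∷_) S)) (⨁-copies m e₁) ⟩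
    ⨁ (map (false ∷_) S) ⊕ ⨁ (map (true ∷_) S) ⊕ 𝟎
      ≡⟨ ⊕-identityʳ _ ⟩
    ⨁ (map (false ∷_) S) ⊕ ⨁ (map (true ∷_) S)
      ≡⟨ cong₂ _⊕_ (⨁-map-false S) (⨁-map-true S) ⟩
    odd (length S) ∷ (⨁ S ⊕ ⨁ S)
      ≡⟨ cong (odd (length S) ∷_) (⊕-self (⨁ S)) ⟩
    odd (length S) ∷ 𝟎 ∎

  odd-l : odd (length S) ≡ true
  odd-l = not-injective (trans (cong odd (length-nonzeros (suc r))) (odd-double (2 ^ r)))

-- The 2m copies of `e₁` add 6m to the total weight, as much as m zero-sum lists need. So m cancels
-- and may be taken arbitrarily large.
extremal-bound : ∀ r m j → HasDisjointZeroSums (vectorGroup (2 + r)) (m + j) (extremal (suc r) m) →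
  3 * j + 3 ≤ 2 ^ (2 + r)
extremal-bound r m j h = *-cancelˡ-≤ 2 (+-cancelʳ-≤ (6 * m) _ _ (begin
  2 * (3 * j + 3) + 6 * m                             ≡⟨ arith₁ j m ⟩
  (m + j) * 6 + 2 + 4                                 ≤⟨ +-monoˡ-≤ 4 (fewZeroSums e₁ m S (extremal-sparse (suc r) m) (⨁-extremal r m) h) ⟩
  2 * length S + mult e₁ S + 4                        ≡⟨ cong (λ n → 2 * length S + n + 4) (mult-e₁-extremal (suc r) m) ⟩
  2 * length S + 2 * m + 4                            ≡⟨ arith₂ (length S) m ⟩
  2 * (2 + length S) + 2 * m                          ≡⟨ cong (λ n → 2 * n + 2 * m) (length-extremal (suc r) m) ⟩
  2 * (2 ^ (2 + r) + 2 * m) + 2 * m                   ≡⟨ arith₃ (2 ^ (2 + r)) m ⟩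
  2 * 2 ^ (2 + r) + 6 * m                             ∎))
  where
  open ≤-Reasoning
  S = extremal (suc r) m
  arith₁ : ∀ j m → 2 * (3 * j + 3) + 6 * m ≡ (m + j) * 6 + 2 + 4
  arith₁ = solve-∀
  arith₂ : ∀ l m → 2 * l + 2 * m + 4 ≡ 2 * (2 + l) + 2 * m
  arith₂ = solve-∀
  arith₃ : ∀ p m → 2 * (p + 2 * m) + 2 * m ≡ 2 * p + 6 * m
  arith₃ = solve-∀

-- The exponent, the ceiling, and the two bounds.

exponent≡2 : ∀ {e} → 1 ≤ r → IsExponent (C₂^ r) e → e ≡ 2
exponent≡2 (s≤s _) ((0<e , e·x≡ε) , least) with least 2 (z<s , λ x i → double (x i))
  where
  double : ∀ a → a xor (a xor false) ≡ false
  double false = refl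
  double true  = refl
exponent≡2 {e = 1} (s≤s _) ((_ , e·x≡ε) , _) | _ with () ← e·x≡ε (λ _ → true) zero
exponent≡2 {e = 2} (s≤s _) _ | _ = refl
exponent≡2 {e = suc (suc (suc _))} (s≤s _) _ | s≤s (s≤s ())

2^r-mod-3 : ∀ r → ∃[ j ] (2 ^ r ≡ 1 + j * 3 ⊎ 2 ^ r ≡ 2 + j * 3)
2^r-mod-3 zero = 0 , inj₁ refl
2^r-mod-3 (suc r) with 2^r-mod-3 r
... | j , inj₁ e = 2 * j , inj₂ (trans (cong (2 *_) e) (arith j))
  where
  arith : ∀ j → 2 * (1 + j * 3) ≡ 2 + 2 * j * 3
  arith = solve-∀
... | j , inj₂ e = 1 + 2 * j , inj₁ (trans (cong (2 *_) e) (arith j))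
  where
  arith : ∀ j → 2 * (2 + j * 3) ≡ 1 + (1 + 2 * j) * 3
  arith = solve-∀

-- `ceiling` is a negated floor, and division of a negative integer branches on the remainder; once
-- remainder and quotient are rewritten, it computes.
ceiling-3j : ∀ j → ceiling (+ (suc j * 3) / 3) ≡ + suc j
ceiling-3j j rewrite m*n%n≡0 (suc j) 3 {{_}} | m*n/n≡m (suc j) 3 {{_}} = cong (+_ ∘ suc) (+-identityʳ j)

ceiling-1+3j : ∀ j → ceiling (+ (1 + j * 3) / 3) ≡ + suc j
ceiling-1+3j j rewrite [m+kn]%n≡m%n 1 j 3 {{_}} | +-distrib-/-∣ʳ 1 {j * 3} {3} {{_}} (divides-refl j) | m*n/n≡m j 3 {{_}} =
  cong (+_ ∘ suc) (+-identityʳ j)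

-- N and j are a third of 2^r - 1 rounded up and down. Since 3 does not divide 2^r, they satisfy N +
-- 2j = 2^r - 1 in both residue classes.
ceiling-bounds : 2 ≤ r → ∃[ N ] ∃[ j ] (ceiling (+ (2 ^ r ∸ 1) / 3) ≡ + N
  × 2 ^ r ≤ 1 + 3 * N × 2 ^ r < 3 * j + 3 × 1 + N + 2 * j ≤ 2 ^ r)
ceiling-bounds {r} 2≤r with 2^r-mod-3 r | ^-monoʳ-≤ 2 2≤r
... | zero , inj₁ e | 4≤2^r with s≤s () ← subst (4 ≤_) e 4≤2^r
... | j@(suc j′) , inj₁ e | _ = j , j , trans (cong (λ n → ceiling (+ (n ∸ 1) / 3)) e) (ceiling-3j j′) ,
  ≤-reflexive (trans e (cong suc (*-comm j 3))) ,
  (begin-strict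
    2 ^ r           ≡⟨ e ⟩
    1 + j * 3       <⟨ m<m+n (1 + j * 3) {2} z<s ⟩
    1 + j * 3 + 2   ≡⟨ arith₁ j ⟩
    3 * j + 3       ∎) ,
  ≤-reflexive (trans (arith₂ j) (sym e))
  where
  open ≤-Reasoning
  arith₁ : ∀ j → 1 + j * 3 + 2 ≡ 3 * j + 3
  arith₁ = solve-∀
  arith₂ : ∀ j → 1 + j + 2 * j ≡ 1 + j * 3
  arith₂ = solve-∀
... | j , inj₂ e | _ = suc j , j , trans (cong (λ n → ceiling (+ (n ∸ 1) / 3)) e) (ceiling-1+3j j) ,
  (begin
    2 ^ r            ≡⟨ e ⟩
    2 + j * 3        ≤⟨ m≤m+n (2 + j * 3) 2 ⟩
    2 + j * 3 + 2    ≡⟨ arith₁ j ⟩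
    1 + 3 * suc j    ∎) ,
  ≤-reflexive (trans (cong suc e) (arith₂ j)) ,
  ≤-reflexive (trans (arith₃ j) (sym e))
  where
  open ≤-Reasoning
  arith₁ : ∀ j → 2 + j * 3 + 2 ≡ 1 + 3 * suc j
  arith₁ = solve-∀
  arith₂ : ∀ j → suc (2 + j * 3) ≡ 3 * j + 3
  arith₂ = solve-∀
  arith₃ : ∀ j → 1 + suc j + 2 * j ≡ 2 + j * 3
  arith₃ = solve-∀

-- If d < N, the extremal list with 2K copies of `e₁` has length 2^r - 2 + 2K ≥ d + 2(K + j). It
-- would then have K + j disjoint zero-sum lists, forcing 3j + 3 ≤ 2^r. Using K in the copies puts K
-- + j beyond the threshold.
lowerBound : ∀ {r} → 2 ≤ r → ∀ {N j d K} → 2 ^ r < 3 * j + 3 → 1 + N + 2 * j ≤ 2 ^ r →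
  (∀ k → K ≤ k → IsD (C₂^ r) k (d + k * 2)) → N ≤ d
lowerBound {suc (suc r)} (s≤s (s≤s _)) {N} {j} {d} {K} 2^r< ≤2^r isD = ≮⇒≥ λ d<N → <⇒≱ 2^r<
  (extremal-bound r K j (hasDisjointZeroSums-lookup S
    (proj₁ (isD (K + j) (m≤m+n K j)) (map Vec.lookup S) (long d<N))))
  where
  open ≤-Reasoning
  S = extremal (suc r) K
  arith : ∀ d K j → 2 + (d + (K + j) * 2) ≡ 1 + suc d + 2 * j + 2 * K
  arith = solve-∀
  long : d < N → d + (K + j) * 2 ≤ length (map Vec.lookup S)
  long d<N = +-cancelˡ-≤ 2 _ _ (begin
    2 + (d + (K + j) * 2)              ≡⟨ arith d K j ⟩
    1 + suc d + 2 * j + 2 * K          ≤⟨ +-monoˡ-≤ (2 * K) (+-monoˡ-≤ (2 * j) (s≤s d<N)) ⟩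
    1 + N + 2 * j + 2 * K              ≤⟨ +-monoˡ-≤ (2 * K) ≤2^r ⟩
    2 ^ (2 + r) + 2 * K                ≡⟨ length-extremal (suc r) K ⟨
    2 + length S                       ≡⟨ cong (λ n → 2 + n) (length-map Vec.lookup S) ⟨
    2 + length (map Vec.lookup S)      ∎)

-- If 2^r < q², lists one term shorter than D_K already have K disjoint zero-sum lists, against
-- minimality. Positivity of q provides the predecessor.
upperBound : 2 ≤ r → ∀ {N q K} → 2 ^ r ≤ 1 + 3 * N → 0 < q → IsD (C₂^ r) K (N + q + K * 2) → q * q ≤ 2 ^ r
upperBound {r} 2≤r {N} {q@(suc q′)} {K} 2^r≤ _ (_ , least) = ≮⇒≥ λ 2^r<q² →
  1+n≰n (subst (_≤ N + q′ + K * 2) predecessor (least (N + q′ + K * 2) λ S len → hasDisjointZeroSums-tabulate S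
    (manyZeroSums 2≤r N q K 2^r≤ 2^r<q² (map Vec.tabulate S) (begin
      N + q + 2 * K                          ≡⟨ cong (λ n → N + q + n) (*-comm 2 K) ⟩
      N + q + K * 2                          ≡⟨ predecessor ⟩
      suc (N + q′ + K * 2)                   ≤⟨ s≤s len ⟩
      suc (length S)                         ≡⟨ cong suc (length-map Vec.tabulate S) ⟨
      suc (length (map Vec.tabulate S))      ∎))))
  where
  open ≤-Reasoning
  predecessor : N + q + K * 2 ≡ suc (N + q′ + K * 2)
  predecessor = cong (_+ K * 2) (+-suc N q′)

theorem7p14 : (r : ℕ) → 2 ≤ r → (d : ℕ) → IsD₀ (C₂^ r) d →
    (ceiling (+ (2 ^ r ∸ 1) / 3) ℤ.≤ + d)
    × ((+ d ℤ.- ceiling (+ (2 ^ r ∸ 1) / 3)) ≤√ (2 ^ r))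
theorem7p14 r 2≤r d (e , isExp , K , isD)
  with refl ← exponent≡2 (≤-trans (s≤s z≤n) 2≤r) isExp
  with N , j , ceil≡N , 2^r≤ , 2^r< , ≤2^r ← ceiling-bounds 2≤r
  rewrite ceil≡N
  = ℤ.+≤+ N≤d , excess (d ∸ N) (sym (m+[n∸m]≡n N≤d))
  where
  N≤d : N ≤ d
  N≤d = lowerBound 2≤r {j = j} 2^r< ≤2^r isD

  -- A zero excess falls under the first alternative of `_≤√_`; a positive one is squared, and the
  -- single index K is enough to bound it.
  excess : ∀ q → d ≡ N + q → (+ d ℤ.- + N) ≤√ (2 ^ r)
  excess q refl rewrite ℤ.m-n≡m⊖n (N + q) N | ℤ.⊖-≥ (m≤m+n N q) | m+n∸m≡n N q with q
  ... | zero  = inj₁ ℤ.≤-refl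
  ... | suc q = inj₂ (subst (ℤ._≤ + (2 ^ r)) (ℤ.pos-* (suc q) (suc q))
                  (ℤ.+≤+ (upperBound 2≤r 2^r≤ z<s (isD K ≤-refl))))
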